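{- Let $s$ be a binary string of length $\ell\ge 2$ consisting only of $0$s. Then no vertex in any parallel chip-firing game on a strongly connected directed graph has $s$ as its atomic firing sequence.
   Context: A directed graph $D=(V,E)$ is a finite set of vertices $V$ with a set $E$ of ordered pairs of vertices; $(u,v)\in E$ is an edge directed from $u$ to $v$, and the out-degree $\deg^+ v$ is the number of edges directed from $v$. It is strongly connected if there is a directed path in both directions between every pair of vertices. A parallel chip-firing game on $D$ starts with a finite nonnegative integer number of chips on each vertex. In each round, simultaneously, every vertex $v$ having at least $\deg^+ v$ chips fires, sending one chip along each of its outgoing edges; all other vertices wait. The game has period $T$ if $T$ is the smallest positive integer for which there is a round $t_0$ such that every vertex has the same number of chips in round $t$ as in round $t+T$ for all $t\ge t_0$. The least such $t_0$ is relabelled round $0$. Let $F_t(v)=1$ if $v$ fires in round $t$ and $F_t(v)=0$ otherwise. The atomic firing sequence of $v$ is the length-$T$ binary string $F_0(v)F_1(v)\cdots F_{T-1}(v)$, where $T$ is the period of the game. -}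

module Defs where

open import Data.Bool using (Bool; if_then_else_)
open import Data.Fin using (Fin)
open import Data.List using (List; length; filter; allFin; applyUpTo)
open import Data.Nat using (ℕ; zero; suc; _+_; _∸_; _≤_; _≥_; _>_; _≤?_)
open import Data.Product using (_×_; ∃-syntax)
open import Level using (0ℓ)
open import Relation.Binary.Construct.Closure.ReflexiveTransitive using (Star)
open import Relation.Binary.Core using (Rel)
open import Relation.Binary.Definitions using (Decidable)
open import Relation.Binary.PropositionalEquality using (_≡_)
open import Relation.Nullary using (Dec; does)
open import Relation.Nullary.Decidable using (_×-dec_)
open import Relation.Unary using (Pred)

-- The edges form a set of ordered pairs: loops are allowed, multiple edges are not.
record Digraph (n : ℕ) : Set₁ where
  field
    Edge  : Rel (Fin n) 0ℓ
    edge? : Decidable Edge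

  outDegree : Fin n → ℕ
  outDegree v = length (filter (edge? v) (allFin n))

  StronglyConnected : Set
  StronglyConnected = ∀ u v → Star Edge u v

Least : Pred ℕ 0ℓ → Pred ℕ 0ℓ
Least P k = P k × (∀ m → P m → k ≤ m)

Configuration : ℕ → Set
Configuration n = Fin n → ℕ

module ChipFiring {n : ℕ} (D : Digraph n) where
  open Digraph D

  Fires : Configuration n → Fin n → Set
  Fires c v = c v ≥ outDegree v

  fires? : ∀ c v → Dec (Fires c v)
  fires? c v = outDegree v ≤? c v

  sent : Configuration n → Fin n → ℕ
  sent c v = if does (fires? c v) then outDegree v else 0

  received : Configuration n → Fin n → ℕ
  received c v = length (filter (λ u → edge? u v ×-dec fires? c u) (allFin n))

  -- The subtraction never truncates, since a vertex that fires has at least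
  -- outDegree v chips.
  step : Configuration n → Configuration n
  step c v = (c v ∸ sent c v) + received c v

  -- Rounds are numbered from the initial configuration c₀.
  module Game (c₀ : Configuration n) where

    chips : ℕ → Configuration n
    chips zero    = c₀
    chips (suc t) = step (chips t)

    -- F t v, with true for 1 and false for 0.
    F : ℕ → Fin n → Bool
    F t v = does (fires? (chips t) v)

    PeriodicFrom : ℕ → ℕ → Set
    PeriodicFrom T t₀ = ∀ t → t ≥ t₀ → ∀ v → chips t v ≡ chips (t + T) v

    HasPeriod : ℕ → Set
    HasPeriod = Least (λ T → T > 0 × ∃[ t₀ ] PeriodicFrom T t₀)

    -- The round t₀ is the one relabelled as round 0.
    IsAtomicFiringSequence : Fin n → List Bool → Set
    IsAtomicFiringSequence v s =
      ∃[ T ] ∃[ t₀ ] HasPeriod T × Least (PeriodicFrom T) t₀ ×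
        s ≡ applyUpTo (λ i → F (t₀ + i) v) T

{-# OPTIONS --safe #-}
-- Chips never leave a vertex that does not fire, so over one period such a vertex
-- cannot receive any either, and its in-neighbours do not fire.  By strong
-- connectivity silence spreads backwards to every vertex; the configuration is then
-- fixed, and the period is 1.
module Submission where

open import Defs
open import Data.Bool using (Bool; false; if_then_else_)
open import Data.Fin using (Fin)
open import Data.List using (List; length; allFin)
open import Data.List.Membership.Propositional using (lose)
open import Data.List.Membership.Propositional.Properties using (∈-allFin)
open import Data.List.Properties using (length-applyUpTo; filter-none; filter-some)
open import Data.List.Relation.Unary.All using (All; universal)
open import Data.List.Relation.Unary.All.Properties using (applyUpTo⁻)
open import Data.Nat using (ℕ; suc; _+_; _∸_; _≤_; _<_; _≥_; _≤′_; z≤n; ≤′-refl; ≤′-step; z<s)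
open import Data.Nat.Properties
open import Data.Product using (_,_)
open import Relation.Binary.Construct.Closure.ReflexiveTransitive using (Star; ε; _◅_)
open import Relation.Binary.PropositionalEquality
  using (_≡_; refl; sym; trans; cong; subst)
open import Relation.Nullary using (¬_; Dec; does; no)
open import Relation.Nullary.Decidable using (_×-dec_; dec-false)

does-false⇒¬ : ∀ {a} {A : Set a} (A? : Dec A) → does A? ≡ false → ¬ A
does-false⇒¬ (no ¬a) refl = ¬a

-- The bound `T` is needed because the chip count of a silent vertex is known not to drop only
-- within one period.
monotone-on : (f : ℕ → ℕ) {T : ℕ} → (∀ i → i < T → f i ≤ f (suc i)) →
  ∀ {i j} → i ≤ j → j ≤ T → f i ≤ f j
monotone-on f {T} mono i≤j = go (≤⇒≤′ i≤j)
  where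
  go : ∀ {i j} → i ≤′ j → j ≤ T → f i ≤ f j
  go ≤′-refl       _   = ≤-refl
  go (≤′-step i≤j) j<T = ≤-trans (go i≤j (<⇒≤ j<T)) (mono _ j<T)

module _ {n : ℕ} (D : Digraph n) where
  open Digraph D
  open ChipFiring D

  step-silent : ∀ c v → ¬ Fires c v → step c v ≡ c v + received c v
  step-silent c v ¬fires = cong (λ b → (c v ∸ (if b then outDegree v else 0)) + received c v)
    (dec-false (fires? c v) ¬fires)

  received-positive : ∀ c {u v} → Edge u v → Fires c u → 0 < received c v
  received-positive c {u} {v} e fires =
    filter-some (λ w → edge? w v ×-dec fires? c w) (lose (∈-allFin u) (e , fires))

  step-stable : ∀ c → (∀ v → ¬ Fires c v) → ∀ v → step c v ≡ c v
  step-stable c stable v = trans (step-silent c v (stable v)) (trans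
    (cong (λ us → c v + length us)
      (filter-none (λ u → edge? u v ×-dec fires? c u)
        (universal (λ u (_ , fires) → stable u fires) (allFin n))))
    (+-identityʳ (c v)))

  module _ (c₀ : Configuration n) where
    open Game c₀

    -- A configuration in which nobody fires is a fixed point of `step`, so it persists forever.
    -- This makes 1 a competitor of the least period.
    stable⇒periodic : ∀ {t₀} → (∀ v → ¬ Fires (chips t₀) v) → PeriodicFrom 1 t₀
    stable⇒periodic {t₀} stable t t≥t₀ v rewrite +-comm t 1 =
      sym (step-stable (chips t) (stays (≤⇒≤′ t≥t₀)) v)
      where
      stays : ∀ {t} → t₀ ≤′ t → ∀ v → ¬ Fires (chips t) v
      stays ≤′-refl             = stable
      stays (≤′-step {t} t₀≤t) v =
        -- Configurations are functions known to agree only pointwise; this suffices, as firing at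
        -- `v` depends on the count at `v` alone.
        subst (λ k → ¬ (k ≥ outDegree v)) (sym (step-stable (chips t) (stays t₀≤t) v))
          (stays t₀≤t v)

    module _ {T t₀ : ℕ} (periodic : PeriodicFrom T t₀) where

      Silent : Fin n → Set
      Silent v = ∀ i → i < T → ¬ Fires (chips (t₀ + i)) v

      -- While `v` is silent its chip count never drops, and a firing of `u` in round `i` raises it
      -- strictly. The count would then end the period above its starting value, against
      -- periodicity.
      silent-predecessor : ∀ {u v} → Edge u v → Silent v → Silent u
      silent-predecessor {u} {v} e silent i i<T fires = <-irrefl start≡end (begin-strict
        f 0        ≤⟨ monotone-on f mono z≤n (<⇒≤ i<T) ⟩
        f i        <⟨ m<m+n (f i) (received-positive (chips (t₀ + i)) e fires) ⟩
        f i + r i  ≡⟨ gain i i<T ⟨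
        f (suc i)  ≤⟨ monotone-on f mono i<T ≤-refl ⟩
        f T        ∎)
        where
        open ≤-Reasoning
        f r : ℕ → ℕ
        f j = chips (t₀ + j) v
        r j = received (chips (t₀ + j)) v
        gain : ∀ j → j < T → f (suc j) ≡ f j + r j
        -- The rewrite exposes `suc (t₀ + j)`, so that `chips` unfolds to one `step`.
        gain j j<T rewrite +-suc t₀ j = step-silent (chips (t₀ + j)) v (silent j j<T)
        mono : ∀ j → j < T → f j ≤ f (suc j)
        mono j j<T = ≤-trans (m≤m+n (f j) (r j)) (≤-reflexive (sym (gain j j<T)))
        start≡end : f 0 ≡ f T
        start≡end = trans (cong (λ t → chips t v) (+-identityʳ t₀)) (periodic t₀ ≤-refl v)

      silent-ancestor : ∀ {u v} → Star Edge u v → Silent v → Silent u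
      silent-ancestor ε        silent = silent
      silent-ancestor (e ◅ es) silent = silent-predecessor e (silent-ancestor es silent)

lemma4p1 : (s : List Bool) → length s ≥ 2 → All (_≡ false) s →
    ∀ {n} (D : Digraph n) → Digraph.StronglyConnected D →
    (c₀ : Configuration n) (v : Fin n) →
    ¬ ChipFiring.Game.IsAtomicFiringSequence D c₀ v s
lemma4p1 s |s|≥2 zeros D connected c₀ v
  (T , t₀ , ((T>0 , _) , T-least) , (periodic , _) , refl) =
  <⇒≱ T≥2 (T-least 1 (z<s , t₀ , stable⇒periodic D c₀ stable))
  where
  open ChipFiring D
  open Game c₀
  T≥2 : T ≥ 2
  -- Matching on `refl` has replaced `s` by the firing sequence itself, whose length is `T`.
  T≥2 = subst (_≥ 2) (length-applyUpTo (λ i → F (t₀ + i) v) T) |s|≥2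
  silent : Silent D c₀ periodic v
  silent i i<T = does-false⇒¬ (fires? (chips (t₀ + i)) v)
    (applyUpTo⁻ (λ i → F (t₀ + i) v) T zeros i<T)
  stable : ∀ u → ¬ Fires (chips t₀) u
  -- A single all-silent round is enough: round 0 of the window, which lies in it because `T` is
  -- positive.
  stable u = subst (λ t → ¬ Fires (chips t) u) (+-identityʳ t₀)
    (silent-ancestor D c₀ periodic (connected u v) silent 0 T>0)
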